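{- Let $G$ be an ordered group and let $S$ be a finite subset of $G$. Then: (i) $|S^2|\ge 2|S|-1$; (ii) if $2|S|-1\le |S^2|\le 3|S|-4$, then $\langle S\rangle$ is abelian and generated by at most $2$ elements; (iii) if $|S^2|=3|S|-3$, then $\langle S\rangle$ is abelian and generated by at most $3$ elements; (iv) if $|S^2|=3|S|-3+b$ for some integer $b\ge 1$, then either $|S|=4$, $b=1$, and $\langle S\rangle$ is abelian and generated by at most $b+3$ elements, or $\langle S\rangle$ is generated by at most $b+2$ elements.
   Context: An ordered group is a group $G$ with a total order $\le$ such that $a\le b$ implies $xay\le xby$ for all $a,b,x,y\in G$. For a subset $S$, $S^2=\{x_1x_2 : x_1,x_2\in S\}$, and $\langle S\rangle$ is the subgroup generated by $S$. -}

module Defs where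

open import Level using (Level; _⊔_; suc)
open import Data.Nat using (ℕ)
open import Data.List using (List; length)
open import Data.List.Membership.Propositional using (_∈_)
open import Data.List.Relation.Unary.Unique.Propositional using (Unique)
open import Data.Product using (Σ; ∃; ∃-syntax; _×_; _,_)
open import Function.Bundles using (_⇔_)
open import Relation.Binary.PropositionalEquality using (_≡_)
open import Relation.Binary.Core using (Rel)
open import Relation.Binary.Structures using (IsTotalOrder)
open import Algebra.Core using (Op₁; Op₂)
open import Algebra.Structures using (IsGroup)

record OrderedGroup (c ℓ : Level) : Set (suc (c ⊔ ℓ)) where
  infixl 7 _∙_
  infix 4 _≤_
  field
    Carrier      : Set c
    _∙_          : Op₂ Carrier
    ε            : Carrier
    _⁻¹          : Op₁ Carrier
    _≤_          : Rel Carrier ℓ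
    isGroup      : IsGroup _≡_ _∙_ ε _⁻¹
    isTotalOrder : IsTotalOrder _≡_ _≤_
    compatible   : ∀ {a b} x y → a ≤ b → x ∙ a ∙ y ≤ x ∙ b ∙ y

module _ {c ℓ : Level} (G : OrderedGroup c ℓ) where
  open OrderedGroup G

  InSq : List Carrier → Carrier → Set c
  InSq S x = ∃[ a ] ∃[ b ] (a ∈ S × b ∈ S × x ≡ a ∙ b)

  -- T is a duplicate-free enumeration of the subset P (so |P| = length T)
  Enumerates : List Carrier → (Carrier → Set c) → Set c
  Enumerates T P = Unique T × (∀ x → (x ∈ T ⇔ P x))

  data Gen (S : List Carrier) : Carrier → Set c where
    gen : ∀ {x} → x ∈ S → Gen S x
    one : Gen S ε
    inv : ∀ {x} → Gen S x → Gen S (x ⁻¹)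
    mul : ∀ {x y} → Gen S x → Gen S y → Gen S (x ∙ y)

  GenAbelian : List Carrier → Set c
  GenAbelian S = ∀ x y → Gen S x → Gen S y → x ∙ y ≡ y ∙ x

  GenBy≤ : List Carrier → ℕ → Set c
  GenBy≤ S k = ∃[ L ] (length L Data.Nat.≤ k × (∀ x → (Gen S x ⇔ Gen L x)))

{-# OPTIONS --safe #-}
-- Sort S decreasingly, S = y ∷ x ∷ R with S' = x ∷ R, and induct on |S| by counting the n new
-- products, those in S² but not in S'².  The products yy and xy exceed all of S'², so n ≥ 2.
-- If n = 2, every r ∈ R has ry and yr in S'², and a downward induction along R puts r in ⟨y , x⟩,
-- while xy = yx.  Otherwise n ≥ 3, and either some ys or sy with s ∈ S' lies in S'², so that
-- ⟨S⟩ = ⟨S'⟩, or none does, so that all of yS is new: then n ≥ |S|, and n > |S| unless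
-- conjugation by y permutes the finite chain S', in which case y centralises S'.
-- The total order is not assumed decidable, but equality is decidable on the members of a
-- duplicate-free list, which is all the counting requires.
module Submission where

open import Defs
open import Level using (Level; _⊔_)
open import Algebra.Bundles using (Group)
open import Algebra.Structures using (IsGroup)
import Algebra.Properties.Group as GroupProperties
open import Data.Nat using (ℕ; zero; suc; _+_; _*_; _≤_; z≤n; s≤s; s≤s⁻¹)
import Data.Nat.Properties as ℕ
open import Data.Nat.Solver using (module +-*-Solver)
open import Data.List using (List; []; _∷_; length; map)
open import Data.List.Properties using (length-map)
open import Data.List.Membership.Propositional using (_∈_)
open import Data.List.Membership.Propositional.Properties using (∈-∃++; ∈-map⁻)
open import Data.List.Relation.Binary.Permutation.Propositional
  using (_↭_; ↭-refl; ↭-sym; ↭-trans; prep; swap)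
open import Data.List.Relation.Binary.Permutation.Propositional.Properties
  using (∈-resp-↭; All-resp-↭; ↭-length; shift)
open import Data.List.Relation.Binary.Subset.Propositional using (_⊆_)
open import Data.List.Relation.Unary.All as All using (All; []; _∷_)
open import Data.List.Relation.Unary.AllPairs as AllPairs using (AllPairs; []; _∷_)
open import Data.List.Relation.Unary.Any using (here; there)
open import Data.List.Relation.Unary.Unique.Propositional using (Unique)
import Data.List.Relation.Unary.Unique.Propositional.Properties as Unique
open import Data.Product using (∃; _×_; _,_; proj₁; proj₂)
open import Data.Sum as Sum using (_⊎_; inj₁; inj₂; [_,_]′)
open import Function using (_∘_; id; flip)
open import Function.Bundles using (mk⇔; Equivalence)
open import Relation.Nullary using (Dec; yes; no; ¬_; contradiction)
open import Relation.Nullary.Decidable using (map′; _⊎-dec_)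
open import Relation.Binary.Structures using (IsTotalOrder)
open import Relation.Binary.PropositionalEquality
  using (_≡_; _≢_; refl; sym; trans; cong; subst; subst₂; ≢-sym; module ≡-Reasoning)
import Relation.Binary.Construct.NonStrictToStrict as Strict

-- Arithmetic of the cardinalities.

open +-*-Solver using (solve; con; _:+_; _:*_; _:=_)

-- Subtraction-free bookkeeping: callers add up their hypotheses to get `L ≤ R`, and `c` collects
-- what both sides share.
≤-cancel : ∀ c {l r L R} → L ≤ R → L ≡ c + l → R ≡ c + r → l ≤ r
≤-cancel c L≤R refl refl = ℕ.+-cancelˡ-≤ c _ _ L≤R

-- Read `j` as |S′|, `t` as |S′²| and `n` as the number of new products, so that |S| is `suc j` and
-- |S²| is `t + n`.
module _ (t n j : ℕ) where

  lower-step : 2 * j ≤ t + 1 → 2 ≤ n → 2 * suc j ≤ t + n + 1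
  lower-step h 2≤n = ≤-cancel 0 (ℕ.+-mono-≤ h 2≤n)
    (solve 1 (λ j → con 2 :* j :+ con 2 := con 2 :* (con 1 :+ j)) refl j)
    (solve 2 (λ t n → t :+ con 1 :+ n := t :+ n :+ con 1) refl t n)

  excess-step : ∀ e f → 3 ≤ n → t + n + e ≤ 3 * suc j + f → t + e ≤ 3 * j + f
  excess-step e f 3≤n h = ≤-cancel (n + 3) (ℕ.+-mono-≤ 3≤n h)
    (solve 3 (λ t n e → con 3 :+ (t :+ n :+ e) := n :+ con 3 :+ (t :+ e)) refl t n e)
    (solve 3 (λ n j f → n :+ (con 3 :* (con 1 :+ j) :+ f) := n :+ con 3 :+ (con 3 :* j :+ f))
      refl n j f)

  -- Since n ≥ 1 + j ≥ 3 + m, an upper bound on |S²| - 3|S| improves by `m` on the way down to S′.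
  fresh-step : ∀ m e f → 1 + j ≤ n → 2 + m ≤ j → t + n + e ≤ 3 * suc j + f → t + (m + e) ≤ 3 * j + f
  fresh-step m e f 1+j≤n m≤j h = ≤-cancel (n + j + 3) (ℕ.+-mono-≤ (ℕ.+-mono-≤ 1+j≤n m≤j) h)
    (solve 5 (λ t n j m e → con 1 :+ j :+ (con 2 :+ m) :+ (t :+ n :+ e) :=
                            n :+ j :+ con 3 :+ (t :+ (m :+ e))) refl t n j m e)
    (solve 3 (λ n j f → n :+ j :+ (con 3 :* (con 1 :+ j) :+ f) :=
                        n :+ j :+ con 3 :+ (con 3 :* j :+ f)) refl n j f)

  fresh-lower : ∀ e → 2 * j ≤ t + 1 → e + j ≤ n → 3 * j + e ≤ t + n + 1
  fresh-lower e h e+j≤n = ≤-cancel 0 (ℕ.+-mono-≤ h e+j≤n)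
    (solve 2 (λ j e → con 2 :* j :+ (e :+ j) := con 3 :* j :+ e) refl j e)
    (solve 2 (λ t n → t :+ con 1 :+ n := t :+ n :+ con 1) refl t n)

  -- Adding t ≥ 2j - 1 and n ≥ j + 2 gives |S²| ≥ 3|S| - 2.
  fresh-noncentral : 2 * j ≤ t + 1 → 2 + j ≤ n → ¬ (t + n + 3 ≤ 3 * suc j)
  fresh-noncentral h 2+j≤n h′ = ℕ.1+n≰n (≤-cancel (t + n + 3 * j + 3)
    (ℕ.+-mono-≤ (fresh-lower 2 h 2+j≤n) h′)
    (solve 3 (λ t n j → con 3 :* j :+ con 2 :+ (t :+ n :+ con 3) :=
                        t :+ n :+ con 3 :* j :+ con 3 :+ con 2) refl t n j)
    (solve 3 (λ t n j → t :+ n :+ con 1 :+ con 3 :* (con 1 :+ j) :=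
                        t :+ n :+ con 3 :* j :+ con 3 :+ con 1) refl t n j))

  -- With only n ≥ j + 1, still |S²| ≥ 3|S| - 3.
  fresh-deficient : 2 * j ≤ t + 1 → 1 + j ≤ n → ¬ (t + n + 4 ≤ 3 * suc j)
  fresh-deficient h 1+j≤n h′ = ℕ.1+n≰n (≤-cancel (t + n + 3 * j + 3)
    (ℕ.+-mono-≤ (fresh-lower 1 h 1+j≤n) h′)
    (solve 3 (λ t n j → con 3 :* j :+ con 1 :+ (t :+ n :+ con 4) :=
                        t :+ n :+ con 3 :* j :+ con 3 :+ con 2) refl t n j)
    (solve 3 (λ t n j → t :+ n :+ con 1 :+ con 3 :* (con 1 :+ j) :=
                        t :+ n :+ con 3 :* j :+ con 3 :+ con 1) refl t n j))

-- Counting and decidability in duplicate-free lists.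

module _ {a} {A : Set a} where

  ∈⇒↭ : ∀ {x : A} {xs} → x ∈ xs → ∃ λ ys → xs ↭ x ∷ ys
  ∈⇒↭ x∈xs with ∈-∃++ x∈xs
  ... | ys , zs , refl = _ , shift _ ys zs

  unique-⊆⇒length≤ : ∀ {xs ys : List A} → Unique xs → xs ⊆ ys → length xs ≤ length ys
  unique-⊆⇒length≤ [] _ = z≤n
  unique-⊆⇒length≤ {x ∷ xs} (x∉xs ∷ u) sub with ∈⇒↭ (sub (here refl))
  ... | zs , ys↭ = subst (suc (length xs) ≤_) (sym (↭-length ys↭)) (s≤s (unique-⊆⇒length≤ u sub′))
    where
    sub′ : xs ⊆ zs
    sub′ z∈xs with ∈-resp-↭ ys↭ (sub (there z∈xs))
    ... | here refl = contradiction refl (All.lookup x∉xs z∈xs)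
    ... | there z∈zs = z∈zs

  -- Positions are compared instead of elements: distinct positions of a duplicate-free list hold
  -- distinct elements.
  unique⇒≡-dec : ∀ {xs : List A} → Unique xs → ∀ {x y} → x ∈ xs → y ∈ xs → Dec (x ≡ y)
  unique⇒≡-dec _ (here refl) (here refl) = yes refl
  unique⇒≡-dec (x∉ ∷ _) (here refl) (there q) = no (All.lookup x∉ q)
  unique⇒≡-dec (x∉ ∷ _) (there p) (here refl) = no (≢-sym (All.lookup x∉ p))
  unique⇒≡-dec (_ ∷ u) (there p) (there q) = unique⇒≡-dec u p q

  module _ {p} {P : A → Set p} where

    ∃∈-dec : ∀ xs → (∀ {x} → x ∈ xs → Dec (P x)) → Dec (∃ λ x → x ∈ xs × P x)
    ∃∈-dec [] _ = no λ { (_ , () , _) }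
    ∃∈-dec (x ∷ xs) P? = map′
      [ (λ px → x , here refl , px) , (λ { (z , z∈ , pz) → z , there z∈ , pz }) ]′
      (λ { (_ , here refl , px) → inj₁ px ; (z , there z∈ , pz) → inj₂ (z , z∈ , pz) })
      (P? (here refl) ⊎-dec ∃∈-dec xs (P? ∘ there))

    ∃¬⊎∀∈ : ∀ xs → (∀ {x} → x ∈ xs → Dec (P x)) →
      (∃ λ x → x ∈ xs × ¬ P x) ⊎ (∀ {x} → x ∈ xs → P x)
    ∃¬⊎∀∈ [] _ = inj₂ λ ()
    ∃¬⊎∀∈ (x ∷ xs) P? with P? (here refl) | ∃¬⊎∀∈ xs (P? ∘ there)
    ... | no ¬px | _ = inj₁ (x , here refl , ¬px)
    ... | yes _ | inj₁ (z , z∈ , ¬pz) = inj₁ (z , there z∈ , ¬pz)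
    ... | yes px | inj₂ all = inj₂ λ { (here refl) → px ; (there z∈) → all z∈ }

    record Split (xs : List A) : Set (a ⊔ p) where
      field
        ins outs    : List A
        unique-ins  : Unique ins
        unique-outs : Unique outs
        ins⊆        : ins ⊆ xs
        outs⊆       : outs ⊆ xs
        ins-P       : All P ins
        outs-¬P     : All (¬_ ∘ P) outs
        length-+    : length xs ≡ length ins + length outs
        covers      : ∀ {x} → x ∈ xs → x ∈ ins ⊎ x ∈ outs

    split : ∀ {xs} → Unique xs → (∀ {x} → x ∈ xs → Dec (P x)) → Split xs
    split [] _ = record
      { ins = [] ; outs = [] ; unique-ins = [] ; unique-outs = [] ; ins⊆ = id ; outs⊆ = id
      ; ins-P = [] ; outs-¬P = [] ; length-+ = refl ; covers = λ () }
    split {x ∷ xs} (x∉xs ∷ u) P? with P? (here refl) | split u (P? ∘ there)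
    ... | yes px | s = record
      { ins = x ∷ ins ; outs = outs
      ; unique-ins = All.tabulate (All.lookup x∉xs ∘ ins⊆) ∷ unique-ins
      ; unique-outs = unique-outs
      ; ins⊆ = λ { (here refl) → here refl ; (there z∈) → there (ins⊆ z∈) }
      ; outs⊆ = there ∘ outs⊆
      ; ins-P = px ∷ ins-P ; outs-¬P = outs-¬P
      ; length-+ = cong suc length-+
      ; covers = λ { (here refl) → inj₁ (here refl)
                   ; (there z∈) → [ inj₁ ∘ there , inj₂ ]′ (covers z∈) } }
      where open Split s
    ... | no ¬px | s = record
      { ins = ins ; outs = x ∷ outs
      ; unique-ins = unique-ins
      ; unique-outs = All.tabulate (All.lookup x∉xs ∘ outs⊆) ∷ unique-outs
      ; ins⊆ = there ∘ ins⊆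
      ; outs⊆ = λ { (here refl) → here refl ; (there z∈) → there (outs⊆ z∈) }
      ; ins-P = ins-P ; outs-¬P = ¬px ∷ outs-¬P
      ; length-+ = trans (cong suc length-+) (sym (ℕ.+-suc _ _))
      ; covers = λ { (here refl) → inj₂ (here refl)
                   ; (there z∈) → [ inj₁ , inj₂ ∘ there ]′ (covers z∈) } }
      where open Split s

-- Strict order and translations in an ordered group.

module _ {c ℓ : Level} (G : OrderedGroup c ℓ) where
  open OrderedGroup G renaming (_≤_ to _≼_)
  open IsGroup isGroup using (assoc; identityˡ; identityʳ; inverseˡ; inverseʳ)
  open IsTotalOrder isTotalOrder
    using (total; antisym; isPartialOrder; ≤-respʳ-≈; ≤-respˡ-≈)
    renaming (refl to ≼-refl; trans to ≼-trans)
  open Strict _≡_ _≼_ using () renaming (_<_ to _≺_)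

  group : Group c c
  group = record { isGroup = isGroup }

  open GroupProperties group
    using (∙-cancelˡ; ∙-cancelʳ; \\-leftDividesʳ; \\-leftDividesˡ; //-rightDividesʳ; //-rightDividesˡ)

  ≺-trans : ∀ {x y z} → x ≺ y → y ≺ z → x ≺ z
  ≺-trans = Strict.<-trans _≡_ _≼_ isPartialOrder

  ≺-≼-trans : ∀ {x y z} → x ≺ y → y ≼ z → x ≺ z
  ≺-≼-trans = Strict.<-≤-trans _≡_ _≼_ sym ≼-trans antisym ≤-respʳ-≈

  ≼-≺-trans : ∀ {x y z} → x ≼ y → y ≺ z → x ≺ z
  ≼-≺-trans = Strict.≤-<-trans _≡_ _≼_ ≼-trans antisym ≤-respˡ-≈

  ≺⇒⋡ : ∀ {x y} → x ≺ y → ¬ (y ≼ x)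
  ≺⇒⋡ = Strict.<⇒≱ _≡_ _≼_ antisym

  ≺-irrefl : ∀ {x} → ¬ (x ≺ x)
  ≺-irrefl (_ , x≢x) = x≢x refl

  ∙-monoʳ-≼ : ∀ z {x y} → x ≼ y → z ∙ x ≼ z ∙ y
  ∙-monoʳ-≼ z x≼y = subst₂ _≼_ (identityʳ _) (identityʳ _) (compatible z ε x≼y)

  ∙-monoˡ-≼ : ∀ z {x y} → x ≼ y → x ∙ z ≼ y ∙ z
  ∙-monoˡ-≼ z x≼y =
    subst₂ _≼_ (cong (_∙ z) (identityˡ _)) (cong (_∙ z) (identityˡ _)) (compatible ε z x≼y)

  ∙-monoʳ-≺ : ∀ z {x y} → x ≺ y → z ∙ x ≺ z ∙ y
  ∙-monoʳ-≺ z (x≼y , x≢y) = ∙-monoʳ-≼ z x≼y , x≢y ∘ ∙-cancelˡ z _ _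

  ∙-monoˡ-≺ : ∀ z {x y} → x ≺ y → x ∙ z ≺ y ∙ z
  ∙-monoˡ-≺ z (x≼y , x≢y) = ∙-monoˡ-≼ z x≼y , x≢y ∘ ∙-cancelʳ z _ _

  ∙-mono-≼ : ∀ {x y u v} → x ≼ y → u ≼ v → x ∙ u ≼ y ∙ v
  ∙-mono-≼ {y = y} {u = u} x≼y u≼v = ≼-trans (∙-monoˡ-≼ u x≼y) (∙-monoʳ-≼ y u≼v)

  -- Decreasing chains.

  Desc : List Carrier → Set (c ⊔ ℓ)
  Desc = AllPairs (flip _≺_)

  desc⇒unique : ∀ {L} → Desc L → Unique L
  desc⇒unique = AllPairs.map (≢-sym ∘ proj₂)

  insert-desc : ∀ {x L} → Desc L → All (x ≢_) L → ∃ λ L′ → x ∷ L ↭ L′ × Desc L′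
  insert-desc [] [] = _ , ↭-refl , [] ∷ []
  insert-desc {x} {h ∷ L} (h> ∷ d) (x≢h ∷ x∉L) with total x h
  ... | inj₂ h≼x = _ , ↭-refl , (h≺x ∷ All.map (λ z≺h → ≺-trans z≺h h≺x) h>) ∷ h> ∷ d
    where
    h≺x : h ≺ x
    h≺x = h≼x , ≢-sym x≢h
  ... | inj₁ x≼h with insert-desc d x∉L
  ...   | L′ , x∷L↭L′ , d′ =
    h ∷ L′ , ↭-trans (swap x h ↭-refl) (prep h x∷L↭L′) ,
    All-resp-↭ x∷L↭L′ ((x≼h , x≢h) ∷ h>) ∷ d′

  sort-desc : ∀ {S} → Unique S → ∃ λ L → S ↭ L × Desc L
  sort-desc [] = [] , ↭-refl , []
  sort-desc {x ∷ S} (x∉S ∷ u) with sort-desc u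
  ... | L , S↭L , d with insert-desc d (All-resp-↭ S↭L x∉S)
  ...   | L′ , x∷L↭L′ , d′ = L′ , ↭-trans (prep x S↭L) x∷L↭L′ , d′

  -- Induction from the greatest element down: at the head no member is larger, so the hypothesis
  -- there is vacuous.
  desc-induction : ∀ {p} {P : Carrier → Set p} {L} → Desc L →
    (∀ {r} → r ∈ L → (∀ {s} → s ∈ L → r ≺ s → P s) → P r) → ∀ {r} → r ∈ L → P r
  desc-induction {P = P} {h ∷ L} (h> ∷ d) step = go
    where
    top : P h
    top = step (here refl) λ
      { (here refl) h≺h → contradiction h≺h ≺-irrefl
      ; (there s∈) h≺s → contradiction (≺-trans h≺s (All.lookup h> s∈)) ≺-irrefl }
    go : ∀ {r} → r ∈ h ∷ L → P r
    go (here refl) = top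
    go (there r∈) = desc-induction d
      (λ r∈ ih → step (there r∈) λ { (here refl) _ → top ; (there s∈) → ih s∈ }) r∈

  -- The greatest element `h` has `f h ≼ h`, so every `s` in the tail has `f s ≺ h`; hence `f` maps
  -- the tail into itself and fixes it by induction.
  monotone-self-map-fixes : ∀ {f : Carrier → Carrier} → (∀ {x y} → x ≺ y → f x ≺ f y) →
    (∀ {x y} → f x ≡ f y → x ≡ y) → ∀ {L} → Desc L → (∀ {s} → s ∈ L → f s ∈ L) →
    ∀ {s} → s ∈ L → f s ≡ s
  monotone-self-map-fixes {f} f-mono f-inj {h ∷ L} (h> ∷ d) self = fixed
    where
    fh≼h : f h ≼ h
    fh≼h with self (here refl)
    ... | here fh≡h = subst (_≼ h) (sym fh≡h) ≼-refl
    ... | there fh∈ = proj₁ (All.lookup h> fh∈)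
    self′ : ∀ {s} → s ∈ L → f s ∈ L
    self′ s∈ with self (there s∈)
    ... | here fs≡h = contradiction
      (subst (_≺ h) fs≡h (≺-≼-trans (f-mono (All.lookup h> s∈)) fh≼h)) ≺-irrefl
    ... | there fs∈ = fs∈
    fixed : ∀ {s} → s ∈ h ∷ L → f s ≡ s
    fixed (there s∈) = monotone-self-map-fixes f-mono f-inj d self′ s∈
    fixed (here refl) with self (here refl)
    ... | here fh≡h = fh≡h
    -- The tail is fixed, so `f (f h) ≡ f h`; injectivity removes one `f`.
    ... | there fh∈ = f-inj (monotone-self-map-fixes f-mono f-inj d self′ fh∈)

  -- Generated subgroups.

  gen-mono : ∀ {S L} → (∀ {s} → s ∈ S → Gen G L s) → ∀ {x} → Gen G S x → Gen G L x
  gen-mono S⊆ (gen s∈) = S⊆ s∈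
  gen-mono S⊆ one = one
  gen-mono S⊆ (inv g) = inv (gen-mono S⊆ g)
  gen-mono S⊆ (mul g h) = mul (gen-mono S⊆ g) (gen-mono S⊆ h)

  gen-∷ : ∀ {y S x} → Gen G S x → Gen G (y ∷ S) x
  gen-∷ = gen-mono (gen ∘ there)

  ∷-gen : ∀ {y S} → Gen G S y → ∀ {x} → Gen G (y ∷ S) x → Gen G S x
  ∷-gen y∈ = gen-mono λ { (here refl) → y∈ ; (there s∈) → gen s∈ }

  commute-⁻¹ : ∀ {z s} → z ∙ s ≡ s ∙ z → z ∙ (s ⁻¹) ≡ (s ⁻¹) ∙ z
  commute-⁻¹ {z} {s} zs≡sz = ∙-cancelˡ s _ _ (begin
    s ∙ (z ∙ (s ⁻¹))   ≡⟨ assoc s z (s ⁻¹) ⟨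
    s ∙ z ∙ (s ⁻¹)     ≡⟨ cong (_∙ (s ⁻¹)) zs≡sz ⟨
    z ∙ s ∙ (s ⁻¹)     ≡⟨ //-rightDividesʳ s z ⟩
    z                  ≡⟨ \\-leftDividesˡ s z ⟨
    s ∙ ((s ⁻¹) ∙ z)   ∎)
    where open ≡-Reasoning

  -- The centraliser of `z` is a subgroup.
  commute-gen : ∀ {S z} → (∀ {s} → s ∈ S → z ∙ s ≡ s ∙ z) → ∀ {x} → Gen G S x → z ∙ x ≡ x ∙ z
  commute-gen comm (gen s∈) = comm s∈
  commute-gen comm one = trans (identityʳ _) (sym (identityˡ _))
  commute-gen comm (inv g) = commute-⁻¹ (commute-gen comm g)
  commute-gen {z = z} comm (mul {x} {y} g h) = begin
    z ∙ (x ∙ y)   ≡⟨ assoc z x y ⟨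
    z ∙ x ∙ y     ≡⟨ cong (_∙ y) (commute-gen comm g) ⟩
    x ∙ z ∙ y     ≡⟨ assoc x z y ⟩
    x ∙ (z ∙ y)   ≡⟨ cong (x ∙_) (commute-gen comm h) ⟩
    x ∙ (y ∙ z)   ≡⟨ assoc x y z ⟨
    x ∙ y ∙ z     ∎
    where open ≡-Reasoning

  commuting⇒abelian : ∀ {S} → (∀ {s t} → s ∈ S → t ∈ S → s ∙ t ≡ t ∙ s) → GenAbelian G S
  commuting⇒abelian comm _ _ gx gy =
    commute-gen (λ t∈ → sym (commute-gen (comm t∈) gx)) gy

  abelian-∷ : ∀ {y S} → GenAbelian G S → (∀ {s} → s ∈ S → y ∙ s ≡ s ∙ y) → GenAbelian G (y ∷ S)
  abelian-∷ ab central = commuting⇒abelian λ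
    { (here refl) (here refl) → refl
    ; (here refl) (there t∈) → central t∈
    ; (there s∈) (here refl) → sym (central s∈)
    ; (there s∈) (there t∈) → ab _ _ (gen s∈) (gen t∈) }

  abelian-[] : GenAbelian G []
  abelian-[] = commuting⇒abelian λ ()

  abelian-mono : ∀ {S L} → (∀ {s} → s ∈ S → Gen G L s) → GenAbelian G L → GenAbelian G S
  abelian-mono S⊆ ab _ _ gx gy = ab _ _ (gen-mono S⊆ gx) (gen-mono S⊆ gy)

  genBy : ∀ {S k} L → length L ≤ k → (∀ {s} → s ∈ S → Gen G L s) →
    (∀ {s} → s ∈ L → Gen G S s) → GenBy≤ G S k
  genBy L L≤k S⊆ L⊆ = L , L≤k , λ _ → mk⇔ (gen-mono S⊆) (gen-mono L⊆)

  genBy-self : ∀ {S k} → length S ≤ k → GenBy≤ G S k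
  genBy-self {S} S≤k = genBy S S≤k gen gen

  genBy-≤ : ∀ {S j k} → j ≤ k → GenBy≤ G S j → GenBy≤ G S k
  genBy-≤ j≤k (L , L≤j , S⇔L) = L , ℕ.≤-trans L≤j j≤k , S⇔L

  genBy-resp : ∀ {S S′ k} → (∀ {s} → s ∈ S → Gen G S′ s) → (∀ {s} → s ∈ S′ → Gen G S s) →
    GenBy≤ G S′ k → GenBy≤ G S k
  genBy-resp S⊆ S′⊆ (L , L≤k , S′⇔L) = genBy L L≤k
    (Equivalence.to (S′⇔L _) ∘ S⊆)
    (gen-mono S′⊆ ∘ Equivalence.from (S′⇔L _) ∘ gen)

  genBy-∷ : ∀ {y S k} → GenBy≤ G S k → GenBy≤ G (y ∷ S) (suc k)
  genBy-∷ {y} (L , L≤k , S⇔L) = genBy (y ∷ L) (s≤s L≤k)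
    (λ { (here refl) → gen (here refl) ; (there s∈) → gen-∷ (Equivalence.to (S⇔L _) (gen s∈)) })
    (λ { (here refl) → gen (here refl) ; (there s∈) → gen-∷ (Equivalence.from (S⇔L _) (gen s∈)) })

  gen-factorˡ : ∀ {S a b} → Gen G S (a ∙ b) → Gen G S b → Gen G S a
  gen-factorˡ {S} {a} {b} gab gb = subst (Gen G S) (//-rightDividesʳ b a) (mul gab (inv gb))

  gen-factorʳ : ∀ {S a b} → Gen G S (a ∙ b) → Gen G S a → Gen G S b
  gen-factorʳ {S} {a} {b} gab ga = subst (Gen G S) (\\-leftDividesʳ a b) (mul (inv ga) gab)

  -- The induction invariant for k = |S| and t = |S²|. The hypotheses are inequalities because
  -- passing to a smaller set only bounds its t from above. `abelian` serves (ii) and (iii)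
  -- together.
  record Bounds (S : List Carrier) (k t : ℕ) : Set c where
    field
      lower   : 2 * k ≤ t + 1
      abelian : t + 3 ≤ 3 * k → GenAbelian G S
      rank≤2  : t + 4 ≤ 3 * k → GenBy≤ G S 2
      -- b is one less than in (iv), so that b = 0 also yields the bound of (iii).
      rank≤3+ : ∀ b → t + 3 ≤ 3 * k + (1 + b) →
        (k ≡ 4 × t ≡ 10 × GenAbelian G S) ⊎ GenBy≤ G S (3 + b)

  -- Products gained by adjoining the greatest element.

  module NewProducts {x y R} (desc : Desc (y ∷ x ∷ R)) {T}
    (enum : Enumerates G T (InSq G (y ∷ x ∷ R))) where

    S′ S : List Carrier
    S′ = x ∷ R
    S = y ∷ S′

    Old New : Carrier → Set c
    Old = InSq G S′
    New z = InSq G S z × ¬ Old z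

    ∈T : ∀ {a b} → a ∈ S → b ∈ S → a ∙ b ∈ T
    ∈T a∈ b∈ = Equivalence.from (proj₂ enum _) (_ , _ , a∈ , b∈ , refl)

    -- `T` contains `z` and all products of members of `S′`, so a finite search with equality on `T`
    -- decides.
    old? : ∀ {z} → z ∈ T → Dec (Old z)
    old? z∈ = map′
      (λ { (a , a∈ , b , b∈ , z≡) → a , b , a∈ , b∈ , z≡ })
      (λ { (a , b , a∈ , b∈ , z≡) → a , a∈ , b , b∈ , z≡ })
      (∃∈-dec S′ λ a∈ → ∃∈-dec S′ λ b∈ →
        unique⇒≡-dec (proj₁ enum) z∈ (∈T (there a∈) (there b∈)))

    open Split (split (proj₁ enum) old?) public

    enum′ : Enumerates G ins Old
    enum′ = unique-ins , λ z → mk⇔ (All.lookup ins-P) (from z)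
      where
      from : ∀ z → Old z → z ∈ ins
      from _ o@(_ , _ , a∈ , b∈ , refl) with covers (∈T (there a∈) (there b∈))
      ... | inj₁ z∈ = z∈
      ... | inj₂ z∈ = contradiction o (All.lookup outs-¬P z∈)

    n : ℕ
    n = length outs

    new⇒length≤n : ∀ {U} → Unique U → (∀ {z} → z ∈ U → New z) → length U ≤ n
    new⇒length≤n u new = unique-⊆⇒length≤ u λ z∈U → from (new z∈U)
      where
      from : ∀ {z} → New z → z ∈ outs
      from (z∈S² , ¬old) with covers (Equivalence.from (proj₂ enum _) z∈S²)
      ... | inj₁ z∈ = contradiction (All.lookup ins-P z∈) ¬old
      ... | inj₂ z∈ = z∈

    new⁺ : ∀ {a b} → a ∈ S → b ∈ S → ¬ Old (a ∙ b) → New (a ∙ b)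
    new⁺ a∈ b∈ ¬old = (_ , _ , a∈ , b∈ , refl) , ¬old

    desc′ : Desc S′
    desc′ = AllPairs.tail desc

    ≺y : ∀ {s} → s ∈ S′ → s ≺ y
    ≺y = All.lookup (AllPairs.head desc)

    R≺x : ∀ {r} → r ∈ R → r ≺ x
    R≺x = All.lookup (AllPairs.head desc′)

    x≺y : x ≺ y
    x≺y = ≺y (here refl)

    ≼x : ∀ {s} → s ∈ S′ → s ≼ x
    ≼x (here refl) = ≼-refl
    ≼x (there r∈) = proj₁ (R≺x r∈)

    xx≺⇒¬old : ∀ {z} → x ∙ x ≺ z → ¬ Old z
    xx≺⇒¬old xx≺z (_ , _ , a∈ , b∈ , refl) = ≺⇒⋡ xx≺z (∙-mono-≼ (≼x a∈) (≼x b∈))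

    new-xy : New (x ∙ y)
    new-xy = new⁺ (there (here refl)) (here refl) (xx≺⇒¬old (∙-monoʳ-≺ x x≺y))

    new-yx : New (y ∙ x)
    new-yx = new⁺ (here refl) (there (here refl)) (xx≺⇒¬old (∙-monoˡ-≺ x x≺y))

    new-yy : New (y ∙ y)
    new-yy = new⁺ (here refl) (here refl)
      (xx≺⇒¬old (≺-trans (∙-monoʳ-≺ x x≺y) (∙-monoˡ-≺ y x≺y)))

    2≤n : 2 ≤ n
    2≤n = new⇒length≤n {x ∙ y ∷ y ∙ y ∷ []}
      ((proj₂ (∙-monoˡ-≺ y x≺y) ∷ []) ∷ [] ∷ [])
      λ { (here refl) → new-xy ; (there (here refl)) → new-yy }

    3≤n : ∀ {z} → New z → z ≢ x ∙ y → z ≢ y ∙ y → 3 ≤ n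
    3≤n {z} new z≢xy z≢yy = new⇒length≤n {z ∷ x ∙ y ∷ y ∙ y ∷ []}
      ((z≢xy ∷ z≢yy ∷ []) ∷ (proj₂ (∙-monoˡ-≺ y x≺y) ∷ []) ∷ [] ∷ [])
      λ { (here refl) → new ; (there (here refl)) → new-xy ; (there (there (here refl))) → new-yy }

    -- Counterpart of `3≤n` for products `y ∙ r`: cancelling `y` on the left separates them from
    -- `y ∙ x` and `y ∙ y`.
    3≤n′ : ∀ {z} → New z → z ≢ y ∙ x → z ≢ y ∙ y → 3 ≤ n
    3≤n′ {z} new z≢yx z≢yy = new⇒length≤n {z ∷ y ∙ x ∷ y ∙ y ∷ []}
      ((z≢yx ∷ z≢yy ∷ []) ∷ (proj₂ (∙-monoʳ-≺ y x≺y) ∷ []) ∷ [] ∷ [])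
      λ { (here refl) → new ; (there (here refl)) → new-yx ; (there (there (here refl))) → new-yy }

    ≺-or-≽ : ∀ {s t} → s ∈ S → t ∈ S → s ≺ t ⊎ t ≼ s
    ≺-or-≽ {s} {t} s∈ t∈ with total s t | unique⇒≡-dec (desc⇒unique desc) s∈ t∈
    ... | inj₂ t≼s | _ = inj₂ t≼s
    ... | inj₁ _ | yes refl = inj₂ ≼-refl
    ... | inj₁ s≼t | no s≢t = inj₁ (s≼t , s≢t)

    -- Let `r ∙ y ≡ a ∙ b` and `y ∙ r ≡ a′ ∙ b′` over `S′`. As all four factors lie below `y`, both
    -- `a` and `b′` lie above `r`. If `b` or `a′` does too, one equation expresses `r` through `y`
    -- and larger members; otherwise the order is contradicted.
    gen-downward : ∀ {E} → y ∈ E → x ∈ E →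
      (∀ {r} → r ∈ R → r ∈ E ⊎ (Old (r ∙ y) × Old (y ∙ r))) → ∀ {s} → s ∈ S → Gen G E s
    gen-downward {E} y∈ x∈ R⊆ = desc-induction desc step
      where
      step : ∀ {r} → r ∈ S → (∀ {s} → s ∈ S → r ≺ s → Gen G E s) → Gen G E r
      step (here refl) _ = gen y∈
      step (there (here refl)) _ = gen x∈
      step {r} r∈S@(there (there r∈)) ih with R⊆ r∈
      ... | inj₁ r∈E = gen r∈E
      ... | inj₂ ((a , b , a∈ , b∈ , ry≡ab) , (a′ , b′ , a′∈ , b′∈ , yr≡a′b′))
        with ≺-or-≽ r∈S (there a∈) | ≺-or-≽ r∈S (there b∈)
           | ≺-or-≽ r∈S (there a′∈) | ≺-or-≽ r∈S (there b′∈)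
      -- From `a ≼ r` follows a b ≼ r b ≺ r y; the next case is its mirror image.
      ... | inj₂ a≼r | _ | _ | _ = contradiction (sym ry≡ab)
        (proj₂ (≼-≺-trans (∙-monoˡ-≼ b a≼r) (∙-monoʳ-≺ r (≺y b∈))))
      ... | _ | _ | _ | inj₂ b′≼r = contradiction (sym yr≡a′b′)
        (proj₂ (≼-≺-trans (∙-monoʳ-≼ a′ b′≼r) (∙-monoˡ-≺ r (≺y a′∈))))
      ... | inj₁ r≺a | inj₁ r≺b | _ | _ = gen-factorˡ
        (subst (Gen G E) (sym ry≡ab) (mul (ih (there a∈) r≺a) (ih (there b∈) r≺b))) (gen y∈)
      ... | _ | _ | inj₁ r≺a′ | inj₁ r≺b′ = gen-factorʳ
        (subst (Gen G E) (sym yr≡a′b′) (mul (ih (there a′∈) r≺a′) (ih (there b′∈) r≺b′))) (gen y∈)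
      -- a b ≼ a r ≺ y r = a′ b′ ≼ r b′ ≺ r y = a b
      ... | inj₁ _ | inj₂ b≼r | inj₂ a′≼r | inj₁ _ = contradiction cycle ≺-irrefl
        where
        cycle : a ∙ b ≺ a ∙ b
        cycle = subst (a ∙ b ≺_) ry≡ab (≺-trans
          (≼-≺-trans (∙-monoʳ-≼ a b≼r) (∙-monoˡ-≺ r (≺y a∈)))
          (subst (_≺ r ∙ y) (sym yr≡a′b′)
            (≼-≺-trans (∙-monoˡ-≼ b′ a′≼r) (∙-monoʳ-≺ r (≺y b′∈)))))

    -- Exactly two new products.

    module TwoNew (n≡2 : n ≡ 2) where

      ¬3≤n : ¬ (3 ≤ n)
      ¬3≤n 3≤n = ℕ.1+n≰n (subst (3 ≤_) n≡2 3≤n)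

      xy≡yx : x ∙ y ≡ y ∙ x
      xy≡yx with unique⇒≡-dec (proj₁ enum) (∈T (there (here refl)) (here refl))
                                            (∈T (here refl) (there (here refl)))
      ... | yes eq = eq
      ... | no xy≢yx =
        contradiction (3≤n new-yx (≢-sym xy≢yx) (proj₂ (∙-monoʳ-≺ y x≺y))) ¬3≤n

      -- Every `r ∙ y` lies strictly below `x ∙ y` and `y ∙ y`, so if new it would be a third new
      -- product; likewise `y ∙ r` against `y ∙ x` and `y ∙ y`.
      gen-yx : ∀ {s} → s ∈ S → Gen G (y ∷ x ∷ []) s
      gen-yx = gen-downward (here refl) (there (here refl)) λ r∈ → inj₂ (ry r∈ , yr r∈)
        where
        ry : ∀ {r} → r ∈ R → Old (r ∙ y)
        ry r∈ with old? (∈T (there (there r∈)) (here refl))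
        ... | yes old = old
        ... | no ¬old = contradiction
          (3≤n (new⁺ (there (there r∈)) (here refl) ¬old)
            (proj₂ (∙-monoˡ-≺ y (R≺x r∈))) (proj₂ (∙-monoˡ-≺ y (≺y (there r∈))))) ¬3≤n
        yr : ∀ {r} → r ∈ R → Old (y ∙ r)
        yr r∈ with old? (∈T (here refl) (there (there r∈)))
        ... | yes old = old
        ... | no ¬old = contradiction
          (3≤n′ (new⁺ (here refl) (there (there r∈)) ¬old)
            (proj₂ (∙-monoʳ-≺ y (R≺x r∈))) (proj₂ (∙-monoʳ-≺ y (≺y (there r∈))))) ¬3≤n

      abelian-S : GenAbelian G S
      abelian-S = abelian-mono gen-yx (abelian-∷ (abelian-∷ abelian-[] λ ())
        λ { (here refl) → sym xy≡yx })

      genBy-2 : GenBy≤ G S 2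
      genBy-2 = genBy (y ∷ x ∷ []) ℕ.≤-refl gen-yx
        λ { (here refl) → gen (here refl) ; (there (here refl)) → gen (there (here refl)) }

    -- Keep `y`, `x` and those `r` for which `y ∙ r` is new: multiplied by `y` they give equally
    -- many distinct new products. For the other `r`, commutativity makes `r ∙ y` old as well, so
    -- `gen-downward` recovers them.
    abelian⇒genBy-n : GenAbelian G S → GenBy≤ G S n
    abelian⇒genBy-n ab = genBy E E≤n
      (gen-downward (here refl) (there (here refl)) R⊆)
      (gen ∘ E⊆S)
      where
      open Split (split (AllPairs.tail (desc⇒unique desc′))
                        (λ r∈ → old? (∈T (here refl) (there (there r∈)))))
        renaming (outs to F; ins to F′; outs⊆ to F⊆R; unique-outs to unique-F; outs-¬P to F-¬old;
                  ins-P to F′-old; covers to F-covers)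
        using ()
      E : List Carrier
      E = y ∷ x ∷ F
      E⊆S : E ⊆ S
      E⊆S (here refl) = here refl
      E⊆S (there (here refl)) = there (here refl)
      E⊆S (there (there r∈)) = there (there (F⊆R r∈))
      R⊆ : ∀ {r} → r ∈ R → r ∈ E ⊎ (Old (r ∙ y) × Old (y ∙ r))
      R⊆ r∈ with F-covers r∈
      ... | inj₂ r∈F = inj₁ (there (there r∈F))
      ... | inj₁ r∈F′ = inj₂ (subst Old (ab _ _ (gen (here refl)) (gen (there (there r∈)))) old , old)
        where old = All.lookup F′-old r∈F′
      unique-E : Unique E
      unique-E =
        (≢-sym (proj₂ x≺y) ∷ All.tabulate (λ r∈ → ≢-sym (proj₂ (≺y (there (F⊆R r∈)))))) ∷
        All.tabulate (λ r∈ → ≢-sym (proj₂ (R≺x (F⊆R r∈)))) ∷ unique-F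
      new-yE : ∀ {e} → e ∈ E → New (y ∙ e)
      new-yE (here refl) = new-yy
      new-yE (there (here refl)) = new-yx
      new-yE (there (there r∈)) =
        new⁺ (here refl) (there (there (F⊆R r∈))) (All.lookup F-¬old r∈)
      E≤n : length E ≤ n
      E≤n = subst (_≤ n) (length-map (y ∙_) E)
        (new⇒length≤n (Unique.map⁺ (∙-cancelˡ y _ _) unique-E) new-map)
        where
        new-map : ∀ {z} → z ∈ map (y ∙_) E → New z
        new-map z∈ with ∈-map⁻ (y ∙_) z∈
        ... | e , e∈ , refl = new-yE e∈

    -- The greatest element: dependent or fresh.

    old⇒gen : ∀ {z} → Old z → Gen G S′ z
    old⇒gen (_ , _ , a∈ , b∈ , refl) = mul (gen a∈) (gen b∈)

    Dependent Fresh : Set c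
    Dependent = Gen G S′ y
    Fresh = ∀ {s} → s ∈ S′ → ¬ Old (y ∙ s) × ¬ Old (s ∙ y)

    -- An old product `y ∙ s` or `s ∙ y` can be solved for `y` inside ⟨S′⟩.
    dependent⊎fresh : Dependent ⊎ Fresh
    dependent⊎fresh with ∃∈-dec S′ (λ s∈ →
      old? (∈T (here refl) (there s∈)) ⊎-dec old? (∈T (there s∈) (here refl)))
    ... | yes (s , s∈ , inj₁ old) = inj₁ (gen-factorˡ (old⇒gen old) (gen s∈))
    ... | yes (s , s∈ , inj₂ old) = inj₁ (gen-factorʳ (old⇒gen old) (gen s∈))
    ... | no none = inj₂ λ s∈ →
      (λ old → none (_ , s∈ , inj₁ old)) , (λ old → none (_ , s∈ , inj₂ old))

    module FreshMax (fresh : Fresh) where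

      yS : List Carrier
      yS = map (y ∙_) S

      new-yS : ∀ {z} → z ∈ yS → New z
      new-yS z∈ with ∈-map⁻ (y ∙_) z∈
      ... | _ , here refl , refl = new-yy
      ... | _ , there s∈ , refl = new⁺ (here refl) (there s∈) (proj₁ (fresh s∈))

      unique-yS : Unique yS
      unique-yS = Unique.map⁺ (∙-cancelˡ y _ _) (desc⇒unique desc)

      |S|≤n : length S ≤ n
      |S|≤n = subst (_≤ n) (length-map (y ∙_) S) (new⇒length≤n unique-yS new-yS)

      conj : Carrier → Carrier
      conj s = (y ⁻¹) ∙ (s ∙ y)

      y∙conj : ∀ s → y ∙ conj s ≡ s ∙ y
      y∙conj s = \\-leftDividesˡ y (s ∙ y)

      central : (∀ {s} → s ∈ S′ → conj s ∈ S′) → ∀ {s} → s ∈ S′ → y ∙ s ≡ s ∙ y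
      central self {s} s∈ = trans (cong (y ∙_) (sym fixed)) (y∙conj s)
        where
        fixed : conj s ≡ s
        fixed = monotone-self-map-fixes (∙-monoʳ-≺ (y ⁻¹) ∘ ∙-monoˡ-≺ y)
          (∙-cancelʳ y _ _ ∘ ∙-cancelˡ (y ⁻¹) _ _) desc′ self s∈

      -- If some `s ∙ y` avoids yS′, it is a new product outside yS, as `s ≺ y` excludes `y ∙ y`.
      -- Otherwise conjugation by `y` maps the chain `S′` monotonically into itself and fixes it.
      |S|<n⊎central : suc (length S) ≤ n ⊎ (∀ {s} → s ∈ S′ → y ∙ s ≡ s ∙ y)
      |S|<n⊎central with ∃¬⊎∀∈ S′ (λ s∈ → ∃∈-dec S′ λ s′∈ →
        unique⇒≡-dec (proj₁ enum) (∈T (there s∈) (here refl)) (∈T (here refl) (there s′∈)))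
      ... | inj₂ all = inj₂ (central self)
        where
        self : ∀ {s} → s ∈ S′ → conj s ∈ S′
        self {s} s∈ with all s∈
        ... | s′ , s′∈ , sy≡ys′ =
          subst (_∈ S′) (∙-cancelˡ y _ _ (trans (sym sy≡ys′) (sym (y∙conj s)))) s′∈
      ... | inj₁ (s , s∈ , sy∉yS′) = inj₁ (subst (λ k → suc k ≤ n) (length-map (y ∙_) S)
        (new⇒length≤n (All.tabulate sy≢ ∷ unique-yS)
          λ { (here refl) → new⁺ (there s∈) (here refl) (proj₂ (fresh s∈))
            ; (there z∈) → new-yS z∈ }))
        where
        sy≢ : ∀ {z} → z ∈ yS → s ∙ y ≢ z
        sy≢ z∈ sy≡z with ∈-map⁻ (y ∙_) z∈
        ... | _ , here refl , refl = proj₂ (∙-monoˡ-≺ y (≺y s∈)) sy≡z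
        ... | _ , there s′∈ , refl = sy∉yS′ (_ , s′∈ , sy≡z)

  -- The induction step.

  module BoundsStep {x y R} (desc : Desc (y ∷ x ∷ R)) {T}
    (enum : Enumerates G T (InSq G (y ∷ x ∷ R)))
    (bounds′ : Bounds (x ∷ R) (length (x ∷ R)) (length (NewProducts.ins desc enum))) where

    open NewProducts desc enum
    open Bounds bounds′
      renaming (lower to lower′; abelian to abelian′; rank≤2 to rank≤2′; rank≤3+ to rank≤3+′)

    t j : ℕ
    t = length ins
    j = length S′

    -- Here ⟨S⟩ = ⟨S′⟩, and n ≥ 3 carries each hypothesis down to `S′`, so all is inherited unless
    -- `S′` is exceptional.
    dependent-step : 3 ≤ n → Dependent → Bounds S (suc j) (t + n)
    dependent-step 3≤n y∈ = record
      { lower = lower-step t n j lower′ 2≤n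
      ; abelian = λ h → abelian-S (abelian′ (drop0 3 h))
      ; rank≤2 = λ h → rank-S (rank≤2′ (drop0 4 h))
      ; rank≤3+ = λ b h → rank b h (rank≤3+′ b (excess-step t n j 3 (1 + b) 3≤n h)) }
      where
      drop0 : ∀ e → t + n + e ≤ 3 * suc j → t + e ≤ 3 * j
      drop0 e h = subst (t + e ≤_) (ℕ.+-identityʳ _)
        (excess-step t n j e 0 3≤n (subst (t + n + e ≤_) (sym (ℕ.+-identityʳ _)) h))
      S⊆ : ∀ {s} → s ∈ S → Gen G S′ s
      S⊆ = ∷-gen y∈ ∘ gen
      abelian-S : GenAbelian G S′ → GenAbelian G S
      abelian-S = abelian-mono S⊆
      rank-S : ∀ {k} → GenBy≤ G S′ k → GenBy≤ G S k
      rank-S = genBy-resp S⊆ (gen ∘ there)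
      rank : ∀ b → t + n + 3 ≤ 3 * suc j + (1 + b) →
        (j ≡ 4 × t ≡ 10 × GenAbelian G S′) ⊎ GenBy≤ G S′ (3 + b) →
        (suc j ≡ 4 × t + n ≡ 10 × GenAbelian G S) ⊎ GenBy≤ G S (3 + b)
      rank b h (inj₂ d≤) = inj₂ (rank-S d≤)
      -- An exceptional `S′` makes |S| = 5, but then 10 + n + 3 ≤ 16 + b, so n ≤ 3 + b and the
      -- abelian bound by `n` suffices.
      rank b h (inj₁ (j≡4 , t≡10 , ab)) =
        inj₂ (genBy-≤ (n≤ j≡4 t≡10 h) (abelian⇒genBy-n (abelian-S ab)))
        where
        n≤ : ∀ {t j} → j ≡ 4 → t ≡ 10 → t + n + 3 ≤ 3 * suc j + (1 + b) → n ≤ 3 + b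
        n≤ refl refl h = ≤-cancel 13 h (cong (10 +_) (ℕ.+-comm n 3)) refl

    fresh-max-step : Fresh → Bounds S (suc j) (t + n)
    fresh-max-step fresh = record
      { lower = lower-step t n j lower′ 2≤n
      ; abelian = λ h → [ (λ k<n → contradiction h (fresh-noncentral t n j lower′ k<n)) , commuting h ]′
                          |S|<n⊎central
      ; rank≤2 = λ h → contradiction h (fresh-deficient t n j lower′ |S|≤n)
      ; rank≤3+ = rank }
      where
      open FreshMax fresh
      commuting : t + n + 3 ≤ 3 * suc j → (∀ {s} → s ∈ S′ → y ∙ s ≡ s ∙ y) → GenAbelian G S
      -- For |S′| ≥ 2 the estimate n ≥ |S| ≥ 3 carries the hypothesis down to `S′`; a singleton
      -- generates an abelian group anyway.
      commuting h central with 2 ℕ.≤? j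
      ... | yes 2≤j = abelian-∷ (abelian′ (subst (t + 3 ≤_) (ℕ.+-identityʳ _)
              (fresh-step t n j 0 3 0 |S|≤n 2≤j (subst (t + n + 3 ≤_) (sym (ℕ.+-identityʳ _)) h))))
              central
      ... | no 2≰j = abelian-∷ (abelian-S′ R (2≰j ∘ s≤s)) central
        where
        abelian-S′ : ∀ R → ¬ (1 ≤ length R) → GenAbelian G (x ∷ R)
        abelian-S′ [] _ = abelian-∷ abelian-[] λ ()
        abelian-S′ (_ ∷ _) ¬1≤ = contradiction (s≤s z≤n) ¬1≤

      rank : ∀ b → t + n + 3 ≤ 3 * suc j + (1 + b) →
        (suc j ≡ 4 × t + n ≡ 10 × GenAbelian G S) ⊎ GenBy≤ G S (3 + b)
      rank b h with suc j ℕ.≤? 3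
      ... | yes k≤3 = inj₂ (genBy-self (ℕ.≤-trans k≤3 (ℕ.m≤m+n 3 b)))
      ... | no k≰3 with s≤s⁻¹ (ℕ.≰⇒> k≰3)
      -- With `m = 1` the allowance falls by one, which pays for the extra generator `y`.
      rank (suc b) h | no _ | 3≤j with rank≤3+′ b (s≤s⁻¹ (subst₂ _≤_ (ℕ.+-suc t 3) (ℕ.+-suc (3 * j) (1 + b))
                                       (fresh-step t n j 1 3 (2 + b) |S|≤n 3≤j h)))
      ... | inj₂ d≤ = inj₂ (genBy-∷ d≤)
      -- Now |S| = 5 ≤ n and 10 + n + 3 ≤ 17 + b give 5 ≤ 4 + b, so `S` itself is short enough.
      ... | inj₁ (j≡4 , t≡10 , _) = inj₂ (genBy-self (5≤ j≡4 t≡10 |S|≤n h))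
        where
        5≤ : ∀ {t j} → j ≡ 4 → t ≡ 10 → suc j ≤ n → t + n + 3 ≤ 3 * suc j + (2 + b) → suc j ≤ 4 + b
        5≤ refl refl 5≤n h = ≤-cancel (n + 13) (ℕ.+-mono-≤ 5≤n h)
          (solve 1 (λ n → con 5 :+ (con 10 :+ n :+ con 3) := n :+ con 13 :+ con 5) refl n)
          (solve 2 (λ n b → n :+ (con 17 :+ b) := n :+ con 13 :+ (con 4 :+ b)) refl n b)
      -- Three generators are allowed, so `S′` should need only two. If |S′| ≥ 4, then `m = 2`
      -- yields t + 4 ≤ 3j.
      rank zero h | no _ | 3≤j with ℕ.m≤n⇒m<n∨m≡n 3≤j
      ... | inj₁ 4≤j = inj₂ (genBy-∷ (rank≤2′ (s≤s⁻¹ (subst₂ _≤_ (ℕ.+-suc t 4) (ℕ.+-comm (3 * j) 1)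
                         (fresh-step t n j 2 3 1 |S|≤n 4≤j h)))))
      -- For |S′| = 3, n ≥ 4 forces t ≤ 6; only t = 6 escapes the two-generator bound.
      ... | inj₂ 3≡j with ℕ.m≤n⇒m<n∨m≡n (t≤6 (sym 3≡j) |S|≤n h)
        where
        t≤6 : ∀ {t j} → j ≡ 3 → suc j ≤ n → t + n + 3 ≤ 3 * suc j + 1 → t ≤ 6
        t≤6 {t} refl 4≤n h = ≤-cancel (n + 7) (ℕ.+-mono-≤ 4≤n h)
          (solve 2 (λ n t → con 4 :+ (t :+ n :+ con 3) := n :+ con 7 :+ t) refl n t)
          (solve 1 (λ n → n :+ con 13 := n :+ con 7 :+ con 6) refl n)
      ...   | inj₁ t<6 = inj₂ (genBy-∷ (rank≤2′ (subst (λ j → t + 4 ≤ 3 * j) 3≡j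
                           (ℕ.+-monoˡ-≤ 4 (s≤s⁻¹ t<6)))))
      ...   | inj₂ t≡6 with |S|<n⊎central
      ...     | inj₁ k<n = contradiction h (h≰ t≡6 (sym 3≡j) k<n)
        where
        h≰ : ∀ {t j} → t ≡ 6 → j ≡ 3 → 2 + j ≤ n → ¬ (t + n + 3 ≤ 3 * suc j + 1)
        h≰ refl refl 5≤n h = ℕ.1+n≰n (≤-cancel (13 + n) (ℕ.+-mono-≤ 5≤n h)
          (solve 1 (λ n → con 5 :+ (con 6 :+ n :+ con 3) := con 13 :+ n :+ con 1) refl n)
          (solve 1 (λ n → n :+ con 13 := con 13 :+ n :+ con 0) refl n))
      -- The exception arises here: t = 6 and n = 4, with `S′` abelian because 6 + 3 ≤ 9.
      ...     | inj₂ central = inj₁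
        ( cong suc (sym 3≡j)
        , t+n≡10 t≡6 (sym 3≡j) |S|≤n h
        , abelian-∷ (abelian′ (subst₂ (λ t j → t + 3 ≤ 3 * j) (sym t≡6) 3≡j ℕ.≤-refl)) central )
        where
        t+n≡10 : ∀ {t j} → t ≡ 6 → j ≡ 3 → suc j ≤ n → t + n + 3 ≤ 3 * suc j + 1 → t + n ≡ 10
        t+n≡10 refl refl 4≤n h = cong (6 +_) (ℕ.≤-antisym
          (≤-cancel 9 h (cong (6 +_) (ℕ.+-comm n 3)) refl) 4≤n)

    step : Bounds S (suc j) (t + n)
    step with ℕ.m≤n⇒m<n∨m≡n 2≤n
    ... | inj₂ 2≡n = record
      { lower = lower-step t n j lower′ 2≤n
      ; abelian = λ _ → abelian-S
      ; rank≤2 = λ _ → genBy-2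
      ; rank≤3+ = λ b _ → inj₂ (genBy-≤ (s≤s (s≤s z≤n)) genBy-2) }
      where open TwoNew (sym 2≡n)
    ... | inj₁ 3≤n = [ dependent-step 3≤n , fresh-max-step ]′ dependent⊎fresh

  -- The induction and its transfer to unsorted lists.

  bounds : ∀ {S T} → Desc S → Enumerates G T (InSq G S) → Bounds S (length S) (length T)
  bounds {[]} _ _ = record
    { lower = z≤n
    ; abelian = λ _ → abelian-[]
    ; rank≤2 = λ _ → genBy-self z≤n
    ; rank≤3+ = λ _ _ → inj₂ (genBy-self z≤n) }
  bounds {x ∷ []} {T} _ enum = record
    { lower = ℕ.+-monoˡ-≤ 1 (1≤length (Equivalence.from (proj₂ enum _)
                                        (x , x , here refl , here refl , refl)))
    ; abelian = λ _ → abelian-∷ abelian-[] λ ()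
    ; rank≤2 = λ _ → genBy-self (s≤s z≤n)
    ; rank≤3+ = λ _ _ → inj₂ (genBy-self (s≤s z≤n)) }
    where
    1≤length : ∀ {z T} → z ∈ T → 1 ≤ length T
    1≤length (here _) = s≤s z≤n
    1≤length (there _) = s≤s z≤n
  bounds {y ∷ x ∷ R} desc enum = subst (Bounds S (length S)) (sym length-+)
    (BoundsStep.step desc enum (bounds desc′ enum′))
    where open NewProducts desc enum

  bounds-unique : ∀ {S T} → Unique S → Enumerates G T (InSq G S) → Bounds S (length S) (length T)
  bounds-unique {S} {T} u (unique-T , T⇔S²) with sort-desc u
  ... | L , S↭L , desc = subst (λ k → Bounds S k (length T)) (sym (↭-length S↭L)) record
    { lower = lower
    ; abelian = abelian-mono S⊆ ∘ abelian
    ; rank≤2 = genBy-resp S⊆ L⊆ ∘ rank≤2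
    ; rank≤3+ = λ b → Sum.map
        (λ (k≡4 , t≡10 , ab) → k≡4 , t≡10 , abelian-mono S⊆ ab) (genBy-resp S⊆ L⊆) ∘ rank≤3+ b }
    where
    S⊆ : ∀ {s} → s ∈ S → Gen G L s
    S⊆ = gen ∘ ∈-resp-↭ S↭L
    L⊆ : ∀ {s} → s ∈ L → Gen G S s
    L⊆ = gen ∘ ∈-resp-↭ (↭-sym S↭L)
    enum-L : Enumerates G T (InSq G L)
    enum-L = unique-T , λ z → mk⇔
      (λ z∈ → resp S↭L (Equivalence.to (T⇔S² z) z∈))
      (λ old → Equivalence.from (T⇔S² z) (resp (↭-sym S↭L) old))
      where
      resp : ∀ {S S′ z} → S ↭ S′ → InSq G S z → InSq G S′ z
      resp p (a , b , a∈ , b∈ , z≡) = a , b , ∈-resp-↭ p a∈ , ∈-resp-↭ p b∈ , z≡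
    open Bounds (bounds desc enum-L)

theorem2p5 : ∀ {c ℓ} (G : OrderedGroup c ℓ) (S T : List (OrderedGroup.Carrier G)) →
    Unique S → Enumerates G T (InSq G S) →
    (2 * length S ≤ length T + 1)
    × (2 * length S ≤ length T + 1 → length T + 4 ≤ 3 * length S →
    GenAbelian G S × GenBy≤ G S 2)
    × (length T + 3 ≡ 3 * length S → GenAbelian G S × GenBy≤ G S 3)
    × (∀ (b : ℕ) → 1 ≤ b → length T + 3 ≡ 3 * length S + b →
    (length S ≡ 4 × b ≡ 1 × GenAbelian G S × GenBy≤ G S (b + 3))
    ⊎ GenBy≤ G S (b + 2))
theorem2p5 G S T u enum = lower , ii , iii , iv
  where
  open Bounds (bounds-unique G u enum)
  t≤ : length T + 4 ≤ 3 * length S → length T + 3 ≤ 3 * length S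
  t≤ = ℕ.≤-trans (ℕ.+-monoʳ-≤ (length T) (ℕ.n≤1+n 3))
  ii : 2 * length S ≤ length T + 1 → length T + 4 ≤ 3 * length S → GenAbelian G S × GenBy≤ G S 2
  ii _ h = abelian (t≤ h) , rank≤2 h
  iii : length T + 3 ≡ 3 * length S → GenAbelian G S × GenBy≤ G S 3
  iii eq with rank≤3+ 0 (ℕ.≤-trans (ℕ.≤-reflexive eq) (ℕ.m≤m+n _ 1))
  ... | inj₂ d≤ = abelian (ℕ.≤-reflexive eq) , d≤
  -- The exception would require 10 + 3 = 3 · 4.
  ... | inj₁ (k≡4 , t≡10 , _) =
    contradiction (trans (cong (_+ 3) (sym t≡10)) (trans eq (cong (3 *_) k≡4))) λ ()
  iv : ∀ b → 1 ≤ b → length T + 3 ≡ 3 * length S + b →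
    (length S ≡ 4 × b ≡ 1 × GenAbelian G S × GenBy≤ G S (b + 3)) ⊎ GenBy≤ G S (b + 2)
  iv (suc b) _ eq with rank≤3+ b (ℕ.≤-reflexive eq)
  ... | inj₂ d≤ = inj₂ (subst (GenBy≤ G S) (ℕ.+-comm 2 (suc b)) d≤)
  -- The four members of `S` generate, and 4 ≤ b + 3 for the exponent b ≥ 1 of (iv), here `suc b`.
  ... | inj₁ (k≡4 , t≡10 , ab) = inj₁ (k≡4 , b≡1 , ab ,
    genBy-self G (ℕ.≤-trans (ℕ.≤-reflexive k≡4) (ℕ.+-monoˡ-≤ 3 (s≤s z≤n))))
    where
    b≡1 : suc b ≡ 1
    b≡1 = ℕ.+-cancelˡ-≡ 12 _ _
      (trans (cong (λ k → 3 * k + suc b) (sym k≡4)) (trans (sym eq) (cong (_+ 3) t≡10)))
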